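{- Let $P\subset\mathbb{R}^d$ be a finite point set satisfying the standing condition, let $\varepsilon\in(0,1)$, and let $Q_\varepsilon$ be the set returned by the algorithm H-GRMR described in the context on input $P$, its extreme point set $X$, its inner-product Delaunay graph $\mathcal{G}(P)$, and $\varepsilon$. Then $Q_\varepsilon$ is an $\varepsilon$-regret set of $P$, i.e., $l(Q_\varepsilon)\le\varepsilon$.
   Context: For finite $Q\subset\mathbb{R}^d$ and unit $x$, $\omega(x,Q)=\max_{p\in Q}\langle p,x\rangle$. Standing condition: $\omega(x,P)>0$ for all $x\in\mathbb{S}^{d-1}$. Regret ratio $l_x(Q)=1-\omega(x,Q)/\omega(x,P)$; $l(Q)=\max_{x\in\mathbb{S}^{d-1}}l_x(Q)$; $Q\subseteq P$ is an $\varepsilon$-regret set if $l(Q)\le\varepsilon$. Voronoi cell $R(p)=\{x\ne0:\langle p,x\rangle\ge\omega(x,P)\}$; extreme points $X=\{t_1,\dots,t_m\}$ are the points with $R(p)\ne\varnothing$. The inner-product Delaunay graph $\mathcal{G}(P)$ is the undirected graph on $X$ with an edge $\{t_i,t_j\}$ iff $R(t_i)\cap R(t_j)\ne\varnothing$; $N(t)$ denotes the neighbors of $t$. For $t_i,t_j\in X$, $\varepsilon_{ij}$ is the optimal value of the linear program: maximize $1-\langle t_i,x\rangle$ over $x\in\mathbb{R}^d$ subject to $\langle t_j-t,x\rangle\ge0$ for all $t\in N(t_j)$ and $\langle t_j,x\rangle=1$ (with $\varepsilon_{ij}=+\infty$ if unbounded). Algorithm H-GRMR: Step 1: start with a directed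 graph $H_\varepsilon$ on $X$ with no edges; for each $t_i$, mark $t_i$ visited, enqueue all of $N(t_i)$, and while the queue is nonempty dequeue $t_j$; if $t_j$ is not visited, mark it visited, compute $\varepsilon_{ij}$, and if $\varepsilon_{ij}\le\varepsilon$ add edge $t_i\to t_j$ to $H_\varepsilon$ and enqueue all of $N(t_j)$ (visited marks are reset for each $t_i$). Step 2: let $Dom(t_i)=\{t_i\}\cup\{t_j: t_i\to t_j \text{ in } H_\varepsilon\}$; set $Q_\varepsilon=\varnothing$, $U=X$; while $U\ne\varnothing$, pick $t^*\in X\setminus Q_\varepsilon$ maximizing $|Dom(t^*)\cap U|$, add $t^*$ to $Q_\varepsilon$ and remove $Dom(t^*)$ from $U$. Return $Q_\varepsilon$. -}

module Defs where

open import Level using (0ℓ)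
open import Algebra.Bundles using (CommutativeRing)
open import Data.Nat.Base as ℕ using (ℕ)
open import Data.Fin.Base using (Fin)
open import Data.Fin.Subset using (Subset; _∈_; _∉_; _∪_; _∩_; _─_; ⁅_⁆; ⊤; ⊥; ∣_∣; Nonempty; Empty)
open import Data.Fin.Subset.Properties using (_∈?_)
open import Data.List.Base using (List; []; _∷_; _++_; map; filter; allFin)
open import Data.List.Relation.Binary.Permutation.Propositional using (_↭_)
open import Data.Product.Base using (Σ; ∃; _×_; _,_; proj₁; proj₂)
open import Data.Vec.Functional using (Vector)
open import Function.Bundles using (_⇔_)
open import Relation.Binary.Bundles using (DecTotalOrder)
open import Relation.Binary.Core using (Rel)
open import Relation.Binary.PropositionalEquality.Core using (_≡_; _≢_)
open import Relation.Binary.Structures using (IsDecTotalOrder)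
open import Relation.Nullary.Construct.Add.Supremum using (_⁺; ⊤⁺; [_])
open import Relation.Nullary.Negation.Core using (¬_)
open import Relation.Unary using (Pred; U)
import Algebra.Properties.Semiring.Sum as Sum
import Data.List.Extrema as Extrema
import Relation.Binary.Construct.Add.Supremum.NonStrict as AddSupremum
import Relation.Binary.Properties.DecTotalOrder as OrderProperties

-- The standard library has no real numbers. They are axiomatised here as a
-- Dedekind-complete totally ordered field, which determines ℝ up to unique
-- isomorphism. Decidability of ≤ makes this the classical real line.

record Reals : Set₁ where
  field
    commutativeRing : CommutativeRing 0ℓ 0ℓ

  open CommutativeRing commutativeRing public

  infix 4 _≤_
  field
    _≤_             : Rel Carrier 0ℓ
    isDecTotalOrder : IsDecTotalOrder _≈_ _≤_
    +-monoʳ-≤       : ∀ z {x y} → x ≤ y → z + x ≤ z + y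
    *-nonneg        : ∀ {x y} → 0# ≤ x → 0# ≤ y → 0# ≤ x * y
    0≉1             : ¬ 0# ≈ 1#
    inverse         : ∀ {x} → ¬ x ≈ 0# → ∃ λ y → x * y ≈ 1#

  IsUpperBound : Pred Carrier 0ℓ → Carrier → Set
  IsUpperBound S b = ∀ {x} → S x → x ≤ b

  field
    complete : (S : Pred Carrier 0ℓ) → ∃ S → ∃ (IsUpperBound S) →
               ∃ λ s → IsUpperBound S s × (∀ {b} → IsUpperBound S b → s ≤ b)

  decTotalOrder : DecTotalOrder 0ℓ 0ℓ 0ℓ
  decTotalOrder = record { isDecTotalOrder = isDecTotalOrder }

  open DecTotalOrder decTotalOrder public using (totalOrder)
  open OrderProperties decTotalOrder public using (_<_)

  quotient : ∀ x y → ¬ y ≈ 0# → Carrier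
  quotient x y y≉0 = x * proj₁ (inverse y≉0)

module Regret (ℝ : Reals) where

  open Reals ℝ
  open Sum semiring using (sum)
  open Extrema totalOrder using (max)
  open AddSupremum _≤_ using (_≤⁺_)

  IsMaximum : {A : Set} → Pred A 0ℓ → (A → Carrier) → Carrier → Set
  IsMaximum S f m = (∃ λ a → S a × f a ≈ m) × (∀ a → S a → f a ≤ m)

  Point : ℕ → Set
  Point d = Vector Carrier d

  module _ {d : ℕ} where

    infix 4 _≋_
    _≋_ : Rel (Point d) 0ℓ
    x ≋ y = ∀ k → x k ≈ y k

    𝟎 : Point d
    𝟎 _ = 0#

    _⊝_ : Point d → Point d → Point d
    (x ⊝ y) k = x k - y k

    ⟨_,_⟩ : Point d → Point d → Carrier
    ⟨ x , y ⟩ = sum (λ k → x k * y k)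

    Sphere : Pred (Point d) 0ℓ
    Sphere x = ⟨ x , x ⟩ ≈ 1#

  elements : ∀ {n} → Subset n → List (Fin n)
  elements {n} S = filter (_∈? S) (allFin n)

  -- A finite point set is enumerated without repetition, so that its subsets
  -- (Q, X, neighbourhoods, …) are exactly the values of Subset size.

  record PointSet (d : ℕ) : Set where
    field
      size     : ℕ
      point    : Fin size → Point d
      distinct : ∀ {i j} → point i ≋ point j → i ≡ j
      nonempty : Nonempty (⊤ {size})

  module _ {d : ℕ} (P : PointSet d) where
    open PointSet P

    -- The first argument of max is itself one of the values ⟨ p , x ⟩, p ∈ Q,
    -- so this is the maximum over Q.

    ω : Point d → (Q : Subset size) → Nonempty Q → Carrier
    ω x Q (i , _) = max (value i) (map value (elements Q))
      where
      value : Fin size → Carrier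
      value j = ⟨ point j , x ⟩

    ωP : Point d → Carrier
    ωP x = ω x ⊤ nonempty

    StandingCondition : Set
    StandingCondition = ∀ x → Sphere x → 0# < ωP x

    VoronoiCell : Fin size → Pred (Point d) 0ℓ
    VoronoiCell i x = (¬ x ≋ 𝟎) × (ωP x ≤ ⟨ point i , x ⟩)

    IsExtremeSet : Subset size → Set
    IsExtremeSet X = ∀ i → i ∈ X ⇔ (∃ λ x → VoronoiCell i x)

    -- N i is the neighbourhood of point i in the inner-product Delaunay graph
    -- on X.

    IsDelaunayGraph : Subset size → (Fin size → Subset size) → Set
    IsDelaunayGraph X N = ∀ i j → j ∈ N i ⇔
      (i ∈ X × j ∈ X × i ≢ j × (∃ λ x → VoronoiCell i x × VoronoiCell j x))

    module _ (standing : StandingCondition) where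

      regretRatio : (Q : Subset size) → Nonempty Q → ∃ Sphere → Carrier
      regretRatio Q Q≠∅ (x , x∈S) = 1# - quotient (ω x Q Q≠∅) (ωP x) ωP≉0
        where
        ωP≉0 : ¬ ωP x ≈ 0#
        ωP≉0 ωP≈0 = proj₂ (standing x x∈S) (sym ωP≈0)

      IsRegret : (Q : Subset size) → Nonempty Q → Carrier → Set
      IsRegret Q Q≠∅ = IsMaximum U (regretRatio Q Q≠∅)

      -- For Q = ∅ neither ω nor the regret is defined, so being a regret set
      -- includes Q ≠ ∅ and the existence of the maximum defining the regret.

      IsRegretSet : Carrier → Subset size → Set
      IsRegretSet ε Q = Σ (Nonempty Q) λ Q≠∅ → ∃ λ l → IsRegret Q Q≠∅ l × l ≤ ε

    module HGRMR (X : Subset size) (N : Fin size → Subset size) (ε : Carrier) where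

      Feasible : Fin size → Pred (Point d) 0ℓ
      Feasible j x = (∀ t → t ∈ N j → 0# ≤ ⟨ point j ⊝ point t , x ⟩)
                   × ⟨ point j , x ⟩ ≈ 1#

      objective : Fin size → Point d → Carrier
      objective i x = 1# - ⟨ point i , x ⟩

      -- IsOptimalValue i j e says that e is the value ε_ij ∈ ℝ ∪ {+∞}.

      data IsOptimalValue (i j : Fin size) : Carrier ⁺ → Set where
        attained  : ∀ {v} → IsMaximum (Feasible j) (objective i) v →
                    IsOptimalValue i j [ v ]
        unbounded : (∀ b → ∃ λ x → Feasible j x × b < objective i x) →
                    IsOptimalValue i j ⊤⁺

      -- Search i queue visited E E′: the while loop for source i, started in
      -- the given state with out-edges E, terminates with out-edges E′.
      -- Neighbours may be enqueued in any order.

      data Search (i : Fin size) :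
             List (Fin size) → Subset size → Subset size → Subset size → Set where
        done   : ∀ {V E} → Search i [] V E E
        skip   : ∀ {j q V E E′} → j ∈ V →
                 Search i q V E E′ → Search i (j ∷ q) V E E′
        accept : ∀ {j q V E E′ e ns} → j ∉ V →
                 IsOptimalValue i j e → e ≤⁺ [ ε ] → ns ↭ elements (N j) →
                 Search i (q ++ ns) (V ∪ ⁅ j ⁆) (E ∪ ⁅ j ⁆) E′ →
                 Search i (j ∷ q) V E E′
        reject : ∀ {j q V E E′ e} → j ∉ V →
                 IsOptimalValue i j e → ¬ e ≤⁺ [ ε ] →
                 Search i q (V ∪ ⁅ j ⁆) E E′ →
                 Search i (j ∷ q) V E E′

      -- H i is the set of out-neighbours of i in H_ε; only i ∈ X matters.

      Step1 : (Fin size → Subset size) → Set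
      Step1 H = ∀ i → i ∈ X →
        ∃ λ ns → ns ↭ elements (N i) × Search i ns ⁅ i ⁆ ⊥ (H i)

      module _ (H : Fin size → Subset size) where

        Dom : Fin size → Subset size
        Dom i = ⁅ i ⁆ ∪ H i

        -- Greedy Q W Q′: the while loop started from Q with uncovered set W returns Q′, with
        -- ties broken arbitrarily.

        data Greedy : Subset size → Subset size → Subset size → Set where
          done : ∀ {Q W} → Empty W → Greedy Q W Q
          pick : ∀ {Q W Q′} t → Nonempty W → t ∈ X → t ∉ Q →
                 (∀ s → s ∈ X → s ∉ Q → ∣ Dom s ∩ W ∣ ℕ.≤ ∣ Dom t ∩ W ∣) →
                 Greedy (Q ∪ ⁅ t ⁆) (W ─ Dom t) Q′ → Greedy Q W Q′

      Returns : Subset size → Set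
      Returns Q = ∃ λ H → Step1 H × Greedy H ⊥ X Q

{-# OPTIONS --safe #-}
module Submission where

-- Every unit x lies in the Voronoi cell of some t_j ∈ X, and the greedy cover
-- provides t_i ∈ Q with t_j ∈ Dom(t_i). If t_i ≠ t_j, then x / ⟨ t_j , x ⟩ is
-- feasible for the linear program of ε_ij ≤ ε, so ⟨ t_i , x ⟩ ≥ (1 - ε) ω(x , P).
--
-- That the supremum defining l(Q) is attained is shown without compactness:
-- by homogeneity, minimising ω(x , Q) / ω(x , P) amounts to minimising l over the
-- polyhedra ⟨ p , x ⟩ ≥ 1, ⟨ q , x ⟩ ≤ l (q ∈ Q), p ∈ P. Fourier–Motzkin
-- elimination of x decides which of them are empty and yields a minimiser on the
-- others, and a square root, obtained from completeness, rescales it to the sphere.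

open import Defs
open import Data.Nat.Base using (ℕ; NonZero; zero; suc)
open import Data.Fin.Base using (Fin; zero; suc)
open import Data.Fin.Subset using (Subset; Nonempty; ⊤) renaming (_∈_ to _∈ˢ_; _⊆_ to _⊆ˢ_)
open import Data.Fin.Subset.Properties using (_∈?_; ∈⊤; ∉⊥; x∈⁅x⁆; x∈⁅y⁆⇒x≡y; x∈p∪q⁺; x∈p∪q⁻; x∈p∧x∉q⇒x∈p─q)
open import Data.List.Base using (List; []; _∷_; _++_; map; filter; cartesianProductWith; allFin)
open import Data.List.Membership.Propositional using (_∈_)
open import Data.List.Membership.Propositional.Properties using (∈-map⁺; ∈-map⁻; ∈-++⁺ˡ; ∈-++⁺ʳ; ∈-++⁻; ∈-filter⁺; ∈-filter⁻; ∈-allFin; ∈-cartesianProductWith⁺; ∈-cartesianProductWith⁻)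
open import Data.List.Relation.Unary.All as All using (All; []; _∷_)
open import Data.List.Relation.Unary.Any using (here; there)
open import Data.Product.Base using (∃; _×_; _,_; proj₁; proj₂)
open import Data.Sum.Base using (_⊎_; inj₁; inj₂)
open import Data.Unit.Base using (tt)
open import Data.Vec.Functional using (head; tail) renaming (_∷_ to _∷ᵛ_)
open import Function.Base using (_∘_; id)
open import Function.Bundles using (Equivalence)
open import Relation.Binary.Bundles using (DecTotalOrder)
open import Relation.Binary.PropositionalEquality.Core as ≡ using (_≡_)
open import Relation.Nullary.Construct.Add.Supremum using ([_])
open import Relation.Nullary.Decidable.Core using (Dec; yes; no; ¬?)
open import Relation.Nullary.Negation.Core using (¬_; contradiction)
import Algebra.Properties.AbelianGroup as AbelianGroupProperties
import Algebra.Properties.Group as GroupProperties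
import Algebra.Properties.Ring as RingProperties
import Algebra.Solver.Ring.NaturalCoefficients.Default as SemiringSolver
import Data.List.Extrema as Extrema
import Relation.Binary.Construct.Add.Supremum.NonStrict as AddSupremum
import Relation.Binary.Reasoning.PartialOrder as ≤-Reasoning

-- Arithmetic of ordered fields.

module OrderedField (ℝ : Reals) where

  open Reals ℝ
  open DecTotalOrder decTotalOrder public using (_≟_; _≤?_; total; poset)
    renaming (refl to ≤-refl; trans to ≤-trans; reflexive to ≤-reflexive; antisym to ≤-antisym)
  open RingProperties ring public using (-‿distribˡ-*; -‿distribʳ-*; x[y-z]≈xy-xz)
  open GroupProperties +-group public
    using () renaming (//-rightDividesˡ to x-y+y≈x; ⁻¹-involutive to -‿involutive; ε⁻¹≈ε to -0≈0)
  open AbelianGroupProperties +-abelianGroup public using () renaming (⁻¹-∙-comm to -‿+-comm)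
  open SemiringSolver commutativeSemiring public using (solve; _:=_; _:+_; _:*_)
  open ≤-Reasoning poset

  ≰⇒> : ∀ {x y} → ¬ x ≤ y → y < x
  ≰⇒> {x} {y} x≰y with total x y
  ... | inj₁ x≤y = contradiction x≤y x≰y
  ... | inj₂ y≤x = y≤x , λ y≈x → x≰y (≤-reflexive (sym y≈x))

  >⇒≰ : ∀ {x y} → y < x → ¬ x ≤ y
  >⇒≰ (y≤x , y≉x) x≤y = y≉x (≤-antisym y≤x x≤y)

  <-≤-trans : ∀ {x y z} → x < y → y ≤ z → x < z
  <-≤-trans x<y@(x≤y , _) y≤z =
    ≤-trans x≤y y≤z , λ x≈z → >⇒≰ x<y (≤-trans y≤z (≤-reflexive (sym x≈z)))

  +-mono-≤ : ∀ {x y u v} → x ≤ y → u ≤ v → x + u ≤ y + v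
  +-mono-≤ {x} {y} {u} {v} x≤y u≤v = begin
    x + u  ≤⟨ +-monoʳ-≤ x u≤v ⟩
    x + v  ≈⟨ +-comm x v ⟩
    v + x  ≤⟨ +-monoʳ-≤ v x≤y ⟩
    v + y  ≈⟨ +-comm v y ⟩
    y + v  ∎

  +-nonneg : ∀ {x y} → 0# ≤ x → 0# ≤ y → 0# ≤ x + y
  +-nonneg 0≤x 0≤y = ≤-trans (≤-reflexive (sym (+-identityˡ 0#))) (+-mono-≤ 0≤x 0≤y)

  x≤x+y : ∀ {x y} → 0# ≤ y → x ≤ x + y
  x≤x+y {x} 0≤y = ≤-trans (≤-reflexive (sym (+-identityʳ x))) (+-monoʳ-≤ x 0≤y)

  y≤x+y : ∀ {x y} → 0# ≤ x → y ≤ x + y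
  y≤x+y {x} {y} 0≤x = ≤-trans (x≤x+y 0≤x) (≤-reflexive (+-comm y x))

  +-cancelˡ-≤ : ∀ z {x y} → z + x ≤ z + y → x ≤ y
  +-cancelˡ-≤ z {x} {y} z+x≤z+y = begin
    x              ≈⟨ lemma x ⟨
    - z + (z + x)  ≤⟨ +-monoʳ-≤ (- z) z+x≤z+y ⟩
    - z + (z + y)  ≈⟨ lemma y ⟩
    y              ∎
    where
    lemma : ∀ w → - z + (z + w) ≈ w
    lemma w = trans (sym (+-assoc (- z) z w)) (trans (+-congʳ (-‿inverseˡ z)) (+-identityˡ w))

  x≤y⇒0≤y-x : ∀ {x y} → x ≤ y → 0# ≤ y - x
  x≤y⇒0≤y-x {x} {y} x≤y = begin
    0#       ≈⟨ -‿inverseˡ x ⟨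
    - x + x  ≤⟨ +-monoʳ-≤ (- x) x≤y ⟩
    - x + y  ≈⟨ +-comm (- x) y ⟩
    y - x    ∎

  0≤y-x⇒x≤y : ∀ {x y} → 0# ≤ y - x → x ≤ y
  0≤y-x⇒x≤y {x} {y} 0≤y-x = ≤-trans (y≤x+y 0≤y-x) (≤-reflexive (x-y+y≈x x y))

  neg-mono-≤ : ∀ {x y} → x ≤ y → - y ≤ - x
  neg-mono-≤ {x} {y} x≤y =
    0≤y-x⇒x≤y (≤-trans (x≤y⇒0≤y-x x≤y) (≤-reflexive (trans (+-comm y (- x)) (+-congˡ (sym (-‿involutive y))))))

  -- Applied with x = 1, this exchanges a regret bound `ε` for a domination factor `1# - ε`, and
  -- back.
  x-y≤z⇒x-z≤y : ∀ {x y z} → x - y ≤ z → x - z ≤ y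
  x-y≤z⇒x-z≤y {x} {y} {z} x-y≤z = +-cancelˡ-≤ z (begin
    z + (x - z)      ≈⟨ trans (+-comm z (x - z)) (x-y+y≈x z x) ⟩
    x                ≈⟨ x-y+y≈x y x ⟨
    (x - y) + y      ≤⟨ +-mono-≤ x-y≤z ≤-refl ⟩
    z + y            ∎)

  *-monoʳ-≤ : ∀ {z x y} → 0# ≤ z → x ≤ y → z * x ≤ z * y
  *-monoʳ-≤ {z} {x} {y} 0≤z x≤y =
    0≤y-x⇒x≤y (≤-trans (*-nonneg 0≤z (x≤y⇒0≤y-x x≤y)) (≤-reflexive (x[y-z]≈xy-xz z y x)))

  *-monoˡ-≤ : ∀ {z x y} → 0# ≤ z → x ≤ y → x * z ≤ y * z
  *-monoˡ-≤ {z} {x} {y} 0≤z x≤y = begin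
    x * z  ≈⟨ *-comm x z ⟩
    z * x  ≤⟨ *-monoʳ-≤ 0≤z x≤y ⟩
    z * y  ≈⟨ *-comm z y ⟩
    y * z  ∎

  neg-nonneg : ∀ {x} → x ≤ 0# → 0# ≤ - x
  neg-nonneg x≤0 = ≤-trans (≤-reflexive (sym -0≈0)) (neg-mono-≤ x≤0)

  *-antimonoʳ-≤ : ∀ {z x y} → z ≤ 0# → x ≤ y → z * y ≤ z * x
  *-antimonoʳ-≤ {z} {x} {y} z≤0 x≤y = begin
    z * y        ≈⟨ lemma y ⟨
    - (- z * y)  ≤⟨ neg-mono-≤ (*-monoʳ-≤ (neg-nonneg z≤0) x≤y) ⟩
    - (- z * x)  ≈⟨ lemma x ⟩
    z * x        ∎
    where
    lemma : ∀ w → - (- z * w) ≈ z * w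
    lemma w = trans (-‿distribˡ-* (- z) w) (*-congʳ (-‿involutive z))

  square-nonneg : ∀ x → 0# ≤ x * x
  square-nonneg x with total 0# x
  ... | inj₁ 0≤x = *-nonneg 0≤x 0≤x
  ... | inj₂ x≤0 = ≤-trans (*-nonneg (neg-nonneg x≤0) (neg-nonneg x≤0)) (≤-reflexive (begin-equality
    - x * - x    ≈⟨ -‿distribˡ-* x (- x) ⟨
    - (x * - x)  ≈⟨ -‿cong (sym (-‿distribʳ-* x x)) ⟩
    - - (x * x)  ≈⟨ -‿involutive (x * x) ⟩
    x * x        ∎))

  0≤1 : 0# ≤ 1#
  0≤1 = ≤-trans (square-nonneg 1#) (≤-reflexive (*-identityˡ 1#))

  0<1 : 0# < 1#
  0<1 = 0≤1 , 0≉1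

  0<x⇒x≉0 : ∀ {x} → 0# < x → ¬ x ≈ 0#
  0<x⇒x≉0 (_ , 0≉x) x≈0 = 0≉x (sym x≈0)

  reciprocal-pos : ∀ {x y} → 0# < x → x * y ≈ 1# → 0# < y
  reciprocal-pos {x} {y} 0<x xy≈1 = ≰⇒> λ y≤0 → >⇒≰ 0<1 (begin
    1#      ≈⟨ xy≈1 ⟨
    x * y   ≤⟨ *-monoʳ-≤ (proj₁ 0<x) y≤0 ⟩
    x * 0#  ≈⟨ zeroʳ x ⟩
    0#      ∎)

  module Reciprocal {x} (0<x : 0# < x) where

    recip : Carrier
    recip = proj₁ (inverse (0<x⇒x≉0 0<x))

    x*recip≈1 : x * recip ≈ 1#
    x*recip≈1 = proj₂ (inverse (0<x⇒x≉0 0<x))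

    recip*x≈1 : recip * x ≈ 1#
    recip*x≈1 = trans (*-comm recip x) x*recip≈1

    0<recip : 0# < recip
    0<recip = reciprocal-pos 0<x x*recip≈1

    0≤recip : 0# ≤ recip
    0≤recip = proj₁ 0<recip

    x*[recip*y]≈y : ∀ y → x * (recip * y) ≈ y
    x*[recip*y]≈y y = trans (sym (*-assoc x recip y)) (trans (*-congʳ x*recip≈1) (*-identityˡ y))

    recip*[x*y]≈y : ∀ y → recip * (x * y) ≈ y
    recip*[x*y]≈y y = trans (sym (*-assoc recip x y)) (trans (*-congʳ recip*x≈1) (*-identityˡ y))

    *-cancelˡ-≤ : ∀ {y z} → x * y ≤ x * z → y ≤ z
    *-cancelˡ-≤ {y} {z} xy≤xz = begin
      y                ≈⟨ recip*[x*y]≈y y ⟨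
      recip * (x * y)  ≤⟨ *-monoʳ-≤ 0≤recip xy≤xz ⟩
      recip * (x * z)  ≈⟨ recip*[x*y]≈y z ⟩
      z                ∎

  *-pos : ∀ {x y} → 0# < x → 0# < y → 0# < x * y
  *-pos {x} {y} 0<x 0<y = ≰⇒> λ xy≤0 → >⇒≰ 0<y
    (Reciprocal.*-cancelˡ-≤ 0<x (≤-trans xy≤0 (≤-reflexive (sym (zeroʳ x)))))

  -- An inverse y of x would give 1 = (x y)² = y² x² ≤ 0.
  square≤0⇒≈0 : ∀ {x} → x * x ≤ 0# → x ≈ 0#
  square≤0⇒≈0 {x} x²≤0 with x ≟ 0#
  ... | yes x≈0 = x≈0
  ... | no  x≉0 = contradiction (begin
    1#                ≈⟨ *-identityˡ 1# ⟨
    1# * 1#           ≈⟨ *-cong xy≈1 xy≈1 ⟨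
    x * y * (x * y)   ≈⟨ solve 2 (λ x y → x :* y :* (x :* y) := y :* y :* (x :* x)) refl x y ⟩
    y * y * (x * x)   ≤⟨ *-monoʳ-≤ (square-nonneg y) x²≤0 ⟩
    y * y * 0#        ≈⟨ zeroʳ (y * y) ⟩
    0#                ∎) (>⇒≰ 0<1)
    where
    y = proj₁ (inverse x≉0)
    xy≈1 = proj₂ (inverse x≉0)

  -- If x ≤ y failed, x would be positive and x x ≤ y y ≤ x y, where x cancels.
  square-reflects-≤ : ∀ {x y} → 0# ≤ y → x * x ≤ y * y → x ≤ y
  square-reflects-≤ {x} {y} 0≤y x²≤y² with x ≤? y
  ... | yes x≤y = x≤y
  ... | no  x≰y = Reciprocal.*-cancelˡ-≤ (≰⇒> (λ x≤0 → x≰y (≤-trans x≤0 0≤y))) (begin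
    x * x  ≤⟨ x²≤y² ⟩
    y * y  ≤⟨ *-monoˡ-≤ 0≤y (proj₁ (≰⇒> x≰y)) ⟩
    x * y  ∎)

  -- Square roots from suprema.

  open Reciprocal

  -- For the supremum r of the t with t² ≤ s put u = s / r. The arithmetic mean
  -- h of r and u bounds all these t, and s / h is one of them; hence r ≤ h and
  -- s / h ≤ r, which say r² ≤ s and s ≤ r².
  sqrt : ∀ {s} → 0# < s → ∃ λ r → 0# < r × r * r ≈ s
  sqrt {s} 0<s@(0≤s , _) = r , 0<r , ≤-antisym r²≤s s≤r²
    where
    S : Carrier → Set
    S t = t * t ≤ s

    0<1+s : 0# < 1# + s
    0<1+s = <-≤-trans 0<1 (x≤x+y 0≤s)

    1+s≤[1+s]² : 1# + s ≤ (1# + s) * (1# + s)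
    1+s≤[1+s]² = begin
      1# + s               ≈⟨ *-identityʳ (1# + s) ⟨
      (1# + s) * 1#        ≤⟨ *-monoʳ-≤ (proj₁ 0<1+s) (x≤x+y 0≤s) ⟩
      (1# + s) * (1# + s)  ∎

    s≤[1+s]² : s ≤ (1# + s) * (1# + s)
    s≤[1+s]² = ≤-trans (y≤x+y 0≤1) 1+s≤[1+s]²

    -- The point s / (1 + s) lies in `S` because s ≤ (1 + s)². Being positive, it also makes the
    -- supremum positive.
    v t₀ : Carrier
    v = recip 0<1+s
    t₀ = s * v

    0<t₀ : 0# < t₀
    0<t₀ = *-pos 0<s (0<recip 0<1+s)

    t₀∈S : S t₀
    t₀∈S = begin
      s * v * (s * v)                            ≈⟨ solve 2 (λ s v → s :* v :* (s :* v) := s :* (v :* v :* s)) refl s v ⟩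
      s * (v * v * s)                            ≤⟨ *-monoʳ-≤ 0≤s (*-monoʳ-≤ (square-nonneg v) s≤[1+s]²) ⟩
      s * (v * v * ((1# + s) * (1# + s)))        ≈⟨ solve 3 (λ s v w → s :* (v :* v :* (w :* w)) := s :* ((v :* w) :* (v :* w))) refl s v (1# + s) ⟩
      s * ((v * (1# + s)) * (v * (1# + s)))      ≈⟨ *-congˡ (*-cong (recip*x≈1 0<1+s) (recip*x≈1 0<1+s)) ⟩
      s * (1# * 1#)                              ≈⟨ *-congˡ (*-identityˡ 1#) ⟩
      s * 1#                                     ≈⟨ *-identityʳ s ⟩
      s                                          ∎

    S-bounded : IsUpperBound S (1# + s)
    S-bounded t²≤s = square-reflects-≤ (proj₁ 0<1+s) (≤-trans t²≤s s≤[1+s]²)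

    supremum = complete S (t₀ , t₀∈S) (1# + s , S-bounded)

    r : Carrier
    r = proj₁ supremum

    0<r : 0# < r
    0<r = <-≤-trans 0<t₀ (proj₁ (proj₂ supremum) t₀∈S)

    u h : Carrier
    u = recip 0<r * s

    0<2 : 0# < 1# + 1#
    0<2 = <-≤-trans 0<1 (x≤x+y 0≤1)

    h = recip 0<2 * (r + u)

    h+h≈r+u : h + h ≈ r + u
    h+h≈r+u = begin-equality
      h + h              ≈⟨ +-cong (*-identityˡ h) (*-identityˡ h) ⟨
      1# * h + 1# * h    ≈⟨ distribʳ h 1# 1# ⟨
      (1# + 1#) * h      ≈⟨ x*[recip*y]≈y 0<2 (r + u) ⟩
      r + u              ∎

    ru≈s : r * u ≈ s
    ru≈s = x*[recip*y]≈y 0<r s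

    0<u : 0# < u
    0<u = *-pos (0<recip 0<r) 0<s

    0<h : 0# < h
    0<h = *-pos (0<recip 0<2) (<-≤-trans 0<r (x≤x+y (proj₁ 0<u)))

    -- In terms of e, h = r + e and u = r + 2 e, so that h² exceeds r u = s by exactly e².
    e : Carrier
    e = h - r

    r+e≈h : r + e ≈ h
    r+e≈h = trans (+-comm r e) (x-y+y≈x r h)

    u≈r+e+e : u ≈ r + e + e
    u≈r+e+e = ≤-antisym (+-cancelˡ-≤ r (≤-reflexive lemma)) (+-cancelˡ-≤ r (≤-reflexive (sym lemma)))
      where
      lemma : r + u ≈ r + (r + e + e)
      lemma = begin-equality
        r + u              ≈⟨ h+h≈r+u ⟨
        h + h              ≈⟨ +-cong r+e≈h r+e≈h ⟨
        (r + e) + (r + e)  ≈⟨ solve 2 (λ r e → (r :+ e) :+ (r :+ e) := r :+ (r :+ e :+ e)) refl r e ⟩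
        r + (r + e + e)    ∎

    s≤h² : s ≤ h * h
    s≤h² = begin
      s                        ≈⟨ ru≈s ⟨
      r * u                    ≈⟨ *-congˡ u≈r+e+e ⟩
      r * (r + e + e)          ≤⟨ x≤x+y (square-nonneg e) ⟩
      r * (r + e + e) + e * e  ≈⟨ solve 2 (λ r e → r :* (r :+ e :+ e) :+ e :* e := (r :+ e) :* (r :+ e)) refl r e ⟩
      (r + e) * (r + e)        ≈⟨ *-cong r+e≈h r+e≈h ⟩
      h * h                    ∎

    r≤h : r ≤ h
    r≤h = proj₂ (proj₂ supremum) λ t²≤s → square-reflects-≤ (proj₁ 0<h) (≤-trans t²≤s s≤h²)

    k : Carrier
    k = recip 0<h * s

    hk≈s : h * k ≈ s
    hk≈s = x*[recip*y]≈y 0<h s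

    k∈S : S k
    k∈S = Reciprocal.*-cancelˡ-≤ (*-pos 0<h 0<h) (begin
      h * h * (k * k)    ≈⟨ solve 2 (λ h k → h :* h :* (k :* k) := h :* k :* (h :* k)) refl h k ⟩
      h * k * (h * k)    ≈⟨ *-cong hk≈s hk≈s ⟩
      s * s              ≤⟨ *-monoˡ-≤ 0≤s s≤h² ⟩
      h * h * s          ∎)

    k≤r : k ≤ r
    k≤r = proj₁ (proj₂ supremum) k∈S

    r²≤s : r * r ≤ s
    r²≤s = begin
      r * r  ≤⟨ *-monoʳ-≤ (proj₁ 0<r) r≤u ⟩
      r * u  ≈⟨ ru≈s ⟩
      s      ∎
      where
      r≤u : r ≤ u
      r≤u = +-cancelˡ-≤ r (≤-trans (+-mono-≤ r≤h r≤h) (≤-reflexive h+h≈r+u))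

    s≤r² : s ≤ r * r
    -- From h k = s, 2 h = r + u and k ≤ r follows 2 s ≤ (r + u) r = s + r².
    s≤r² = +-cancelˡ-≤ s (begin
      s + s          ≈⟨ +-cong hk≈s hk≈s ⟨
      h * k + h * k  ≈⟨ distribʳ k h h ⟨
      (h + h) * k    ≤⟨ *-monoʳ-≤ (+-nonneg (proj₁ 0<h) (proj₁ 0<h)) k≤r ⟩
      (h + h) * r    ≈⟨ *-congʳ h+h≈r+u ⟩
      (r + u) * r    ≈⟨ solve 2 (λ r u → (r :+ u) :* r := r :* u :+ r :* r) refl r u ⟩
      r * u + r * r  ≈⟨ +-congʳ ru≈s ⟩
      s + r * r      ∎)

-- Bilinearity of the inner product and normalisation of vectors.

module InnerProduct (ℝ : Reals) where

  open Reals ℝ hiding (zero)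
  open Regret ℝ
  open OrderedField ℝ
  open ≤-Reasoning poset

  infixr 7 _·_
  _·_ : ∀ {n} → Carrier → Point n → Point n
  (c · x) k = c * x k

  ⟨⟩-linearˡ : ∀ {n} u v (a b x : Point n) →
               ⟨ (λ k → u * a k + v * b k) , x ⟩ ≈ u * ⟨ a , x ⟩ + v * ⟨ b , x ⟩
  ⟨⟩-linearˡ {zero}  u v a b x = sym (trans (+-cong (zeroʳ u) (zeroʳ v)) (+-identityˡ 0#))
  ⟨⟩-linearˡ {suc n} u v a b x = begin-equality
    (u * a₀ + v * b₀) * x₀ + ⟨ (λ k → u * tail a k + v * tail b k) , tail x ⟩
      ≈⟨ +-congˡ (⟨⟩-linearˡ u v (tail a) (tail b) (tail x)) ⟩
    (u * a₀ + v * b₀) * x₀ + (u * ⟨ tail a , tail x ⟩ + v * ⟨ tail b , tail x ⟩)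
      ≈⟨ solve 7 (λ u v a b x p q → (u :* a :+ v :* b) :* x :+ (u :* p :+ v :* q)
                   := u :* (a :* x :+ p) :+ v :* (b :* x :+ q))
               refl u v a₀ b₀ x₀ ⟨ tail a , tail x ⟩ ⟨ tail b , tail x ⟩ ⟩
    u * ⟨ a , x ⟩ + v * ⟨ b , x ⟩ ∎
    where
    a₀ = head a
    b₀ = head b
    x₀ = head x

  ⟨⟩-·ʳ : ∀ {n} c (a x : Point n) → ⟨ a , c · x ⟩ ≈ c * ⟨ a , x ⟩
  ⟨⟩-·ʳ {zero}  c a x = sym (zeroʳ c)
  ⟨⟩-·ʳ {suc n} c a x = begin-equality
    head a * (c * head x) + ⟨ tail a , c · tail x ⟩
      ≈⟨ +-congˡ (⟨⟩-·ʳ c (tail a) (tail x)) ⟩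
    head a * (c * head x) + c * ⟨ tail a , tail x ⟩
      ≈⟨ solve 4 (λ c a x p → a :* (c :* x) :+ c :* p := c :* (a :* x :+ p))
               refl c (head a) (head x) ⟨ tail a , tail x ⟩ ⟩
    c * ⟨ a , x ⟩ ∎

  ⟨⟩-·-· : ∀ {n} c (x : Point n) → ⟨ c · x , c · x ⟩ ≈ c * c * ⟨ x , x ⟩
  ⟨⟩-·-· {zero}  c x = sym (zeroʳ (c * c))
  ⟨⟩-·-· {suc n} c x = begin-equality
    c * head x * (c * head x) + ⟨ c · tail x , c · tail x ⟩
      ≈⟨ +-congˡ (⟨⟩-·-· c (tail x)) ⟩
    c * head x * (c * head x) + c * c * ⟨ tail x , tail x ⟩
      ≈⟨ solve 3 (λ c x p → c :* x :* (c :* x) :+ c :* c :* p := c :* c :* (x :* x :+ p))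
               refl c (head x) ⟨ tail x , tail x ⟩ ⟩
    c * c * ⟨ x , x ⟩ ∎

  -- Written as a sum because the semiring solver does not treat subtraction; each coordinate
  -- difference enters it as an atom.
  ⟨⟩-⊝ˡ : ∀ {n} (a b x : Point n) → ⟨ a ⊝ b , x ⟩ + ⟨ b , x ⟩ ≈ ⟨ a , x ⟩
  ⟨⟩-⊝ˡ {zero}  a b x = +-identityˡ 0#
  ⟨⟩-⊝ˡ {suc n} a b x = begin-equality
    (a₀ - b₀) * x₀ + ⟨ tail a ⊝ tail b , tail x ⟩ + (b₀ * x₀ + ⟨ tail b , tail x ⟩)
      ≈⟨ solve 5 (λ d b x p q → d :* x :+ p :+ (b :* x :+ q) := (d :+ b) :* x :+ (p :+ q))
               refl (a₀ - b₀) b₀ x₀ ⟨ tail a ⊝ tail b , tail x ⟩ ⟨ tail b , tail x ⟩ ⟩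
    (a₀ - b₀ + b₀) * x₀ + (⟨ tail a ⊝ tail b , tail x ⟩ + ⟨ tail b , tail x ⟩)
      ≈⟨ +-cong (*-congʳ (x-y+y≈x b₀ a₀)) (⟨⟩-⊝ˡ (tail a) (tail b) (tail x)) ⟩
    ⟨ a , x ⟩ ∎
    where
    a₀ = head a
    b₀ = head b
    x₀ = head x

  ⟨x,x⟩-nonneg : ∀ {n} (x : Point n) → 0# ≤ ⟨ x , x ⟩
  ⟨x,x⟩-nonneg {zero}  x = ≤-refl
  ⟨x,x⟩-nonneg {suc n} x = +-nonneg (square-nonneg (head x)) (⟨x,x⟩-nonneg (tail x))

  -- A sum of squares that is at most zero vanishes termwise, so every coordinate of x is zero. This
  -- is the degenerate case of Cauchy-Schwarz.
  ⟨x,x⟩≤0⇒⟨a,x⟩≈0 : ∀ {n} (a x : Point n) → ⟨ x , x ⟩ ≤ 0# → ⟨ a , x ⟩ ≈ 0#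
  ⟨x,x⟩≤0⇒⟨a,x⟩≈0 {zero}  a x x²≤0 = refl
  ⟨x,x⟩≤0⇒⟨a,x⟩≈0 {suc n} a x x²≤0 = begin-equality
    head a * head x + ⟨ tail a , tail x ⟩
      ≈⟨ +-cong (*-congˡ (square≤0⇒≈0 (≤-trans (x≤x+y (⟨x,x⟩-nonneg (tail x))) x²≤0)))
                (⟨x,x⟩≤0⇒⟨a,x⟩≈0 (tail a) (tail x) (≤-trans (y≤x+y (square-nonneg (head x))) x²≤0)) ⟩
    head a * 0# + 0#  ≈⟨ +-identityʳ (head a * 0#) ⟩
    head a * 0#       ≈⟨ zeroʳ (head a) ⟩
    0#                ∎

  ⟨⟩-negˡ : ∀ {n} (a x : Point n) → ⟨ (λ k → - a k) , x ⟩ ≈ - ⟨ a , x ⟩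
  ⟨⟩-negˡ {zero}  a x = sym -0≈0
  ⟨⟩-negˡ {suc n} a x = begin-equality
    - head a * head x + ⟨ (λ k → - tail a k) , tail x ⟩
      ≈⟨ +-cong (sym (-‿distribˡ-* (head a) (head x))) (⟨⟩-negˡ (tail a) (tail x)) ⟩
    - (head a * head x) + - ⟨ tail a , tail x ⟩
      ≈⟨ -‿+-comm (head a * head x) ⟨ tail a , tail x ⟩ ⟩
    - ⟨ a , x ⟩ ∎

  ⟨⟩-zeroʳ : ∀ {n} (a x : Point n) → x ≋ 𝟎 → ⟨ a , x ⟩ ≈ 0#
  ⟨⟩-zeroʳ {zero}  a x x≋𝟎 = refl
  ⟨⟩-zeroʳ {suc n} a x x≋𝟎 = trans
    (+-cong (trans (*-congˡ (x≋𝟎 zero)) (zeroʳ (head a))) (⟨⟩-zeroʳ (tail a) (tail x) (x≋𝟎 ∘ suc)))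
    (+-identityˡ 0#)

  unitVector : ∀ {n} → ∃ λ (x : Point (suc n)) → Sphere x
  unitVector {n} = 1# ∷ᵛ 𝟎 , trans (+-cong (*-identityˡ 1#) (⟨⟩-zeroʳ {n} 𝟎 𝟎 (λ _ → refl))) (+-identityʳ 1#)

  -- The pairing with a forces ⟨ x , x ⟩ to be positive, so the reciprocal of its square root can
  -- serve as c.
  normalise : ∀ {n} (a x : Point n) → 1# ≤ ⟨ a , x ⟩ → ∃ λ c → 0# < c × Sphere (c · x)
  normalise a x 1≤⟨a,x⟩ = c , 0<recip 0<r , (begin-equality
    ⟨ c · x , c · x ⟩   ≈⟨ ⟨⟩-·-· c x ⟩
    c * c * ⟨ x , x ⟩   ≈⟨ *-congˡ r²≈⟨x,x⟩ ⟨
    c * c * (r * r)     ≈⟨ solve 2 (λ c r → c :* c :* (r :* r) := c :* r :* (c :* r)) refl c r ⟩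
    c * r * (c * r)     ≈⟨ *-cong (recip*x≈1 0<r) (recip*x≈1 0<r) ⟩
    1# * 1#             ≈⟨ *-identityˡ 1# ⟩
    1#                  ∎)
    where
    open Reciprocal
    0<⟨x,x⟩ : 0# < ⟨ x , x ⟩
    0<⟨x,x⟩ = ≰⇒> λ x²≤0 → >⇒≰ 0<1 (≤-trans 1≤⟨a,x⟩ (≤-reflexive (⟨x,x⟩≤0⇒⟨a,x⟩≈0 a x x²≤0)))
    root = sqrt 0<⟨x,x⟩
    r = proj₁ root
    0<r = proj₁ (proj₂ root)
    r²≈⟨x,x⟩ = proj₂ (proj₂ root)
    c = recip 0<r

-- Least elements of sets of reals, and linear systems with a parameter.

module Optimisation (ℝ : Reals) where

  open Reals ℝ hiding (zero)
  open Regret ℝ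
  open OrderedField ℝ
  open InnerProduct ℝ
  open Extrema totalOrder using (max; min; ⊥≤max; xs≤max; max≤v⁺; min≤xs)
  open ≤-Reasoning poset

  Least : (Carrier → Set) → Set
  Least A = ∃ λ m → A m × (∀ {l} → A l → m ≤ l)

  -- Emptiness is the only alternative to a minimum: an infimum that is not attained and
  -- unboundedness below are both excluded.
  EmptyOrLeast : (Carrier → Set) → Set
  EmptyOrLeast A = (∀ {l} → ¬ A l) ⊎ Least A

  emptyOrLeast-resp : ∀ {A B : Carrier → Set} → (∀ {l} → A l → B l) → (∀ {l} → B l → A l) →
                      EmptyOrLeast A → EmptyOrLeast B
  emptyOrLeast-resp f g (inj₁ ∄A)             = inj₁ (∄A ∘ g)
  emptyOrLeast-resp f g (inj₂ (m , Am , m≤A)) = inj₂ (m , f Am , m≤A ∘ g)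

  -- The minimum of a finite union is the smallest of the minima of its nonempty members. Later the
  -- union runs over the points p of `P`.
  emptyOrLeast-∃ : ∀ {n} {A : Fin n → Carrier → Set} → (∀ i → EmptyOrLeast (A i)) →
                   EmptyOrLeast (λ l → ∃ λ i → A i l)
  emptyOrLeast-∃ {zero}  A? = inj₁ λ ()
  emptyOrLeast-∃ {suc n} A? with A? zero | emptyOrLeast-∃ (A? ∘ suc)
  ... | inj₁ ∄A₀             | inj₁ ∄A = inj₁ λ { (zero , a) → ∄A₀ a ; (suc i , a) → ∄A (i , a) }
  ... | inj₂ (m , Am , m≤A₀) | inj₁ ∄A =
    inj₂ (m , (zero , Am) , λ { (zero , a) → m≤A₀ a ; (suc i , a) → contradiction (i , a) ∄A })
  ... | inj₁ ∄A₀             | inj₂ (m , (j , Am) , m≤A) =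
    inj₂ (m , (suc j , Am) , λ { (zero , a) → contradiction a ∄A₀ ; (suc i , a) → m≤A (i , a) })
  ... | inj₂ (m₀ , Am₀ , m₀≤A₀) | inj₂ (m , (j , Am) , m≤A) with total m₀ m
  ...   | inj₁ m₀≤m = inj₂ (m₀ , (zero , Am₀) , λ { (zero , a) → m₀≤A₀ a ; (suc i , a) → ≤-trans m₀≤m (m≤A (i , a)) })
  ...   | inj₂ m≤m₀ = inj₂ (m , (suc j , Am) , λ { (zero , a) → ≤-trans m≤m₀ (m₀≤A₀ a) ; (suc i , a) → m≤A (i , a) })

  -- The inequality 0 ≤ ⟨ coefficients , x ⟩ + slope l + constant in a point x
  -- and the real l to be minimised.
  record Constraint (n : ℕ) : Set where
    constructor constraint
    field
      coefficients : Point n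
      slope        : Carrier
      constant     : Carrier

  open Constraint

  value : ∀ {n} → Constraint n → Point n → Carrier → Carrier
  value c x l = ⟨ coefficients c , x ⟩ + (slope c * l + constant c)

  Satisfies : ∀ {n} → List (Constraint n) → Point n → Carrier → Set
  Satisfies L x l = All (λ c → 0# ≤ value c x l) L

  -- With nonnegative slopes, a solution x for l remains one for every larger l, so constraints can
  -- bound l only from below.
  MonotoneSystem : ∀ {n} → List (Constraint n) → Set
  MonotoneSystem L = All (λ c → 0# ≤ slope c) L

  -- Fourier-Motzkin elimination of one variable.

  module _ {n : ℕ} where

    leading : Constraint (suc n) → Carrier
    leading c = head (coefficients c)

    rest : Constraint (suc n) → Constraint n
    rest c = constraint (tail (coefficients c)) (slope c) (constant c)

    -- The multipliers u and v are chosen so that the first variable cancels. Both are positive when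
    -- p is `Positive` and q is `Negative`.
    combine : Constraint (suc n) → Constraint (suc n) → Constraint n
    combine p q = constraint (λ k → u * coefficients p (suc k) + v * coefficients q (suc k))
                             (u * slope p + v * slope q) (u * constant p + v * constant q)
      where
      u = - leading q
      v = leading p

    -- Strict signs are negated inequalities, which makes them decidable by `¬?`; `≰⇒>` recovers the
    -- strict order.
    Vanishing Positive Negative : Constraint (suc n) → Set
    Vanishing c = leading c ≈ 0#
    Positive  c = ¬ leading c ≤ 0#
    Negative  c = ¬ 0# ≤ leading c

    vanishing? : ∀ c → Dec (Vanishing c)
    vanishing? c = leading c ≟ 0#

    positive? : ∀ c → Dec (Positive c)
    positive? c = ¬? (leading c ≤? 0#)

    negative? : ∀ c → Dec (Negative c)
    negative? c = ¬? (0# ≤? leading c)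

    -- A `Positive` constraint bounds the first variable from below and a `Negative` one from above.
    -- Each such pair contributes the condition that its two bounds are compatible.
    eliminate : List (Constraint (suc n)) → List (Constraint n)
    eliminate L = map rest (filter vanishing? L)
               ++ cartesianProductWith combine (filter positive? L) (filter negative? L)

    eliminate⁺ : ∀ {A : Constraint n → Set} L →
                 (∀ {c} → c ∈ L → Vanishing c → A (rest c)) →
                 (∀ {p q} → p ∈ L → q ∈ L → Positive p → Negative q → A (combine p q)) →
                 All A (eliminate L)
    eliminate⁺ {A} L A-rest A-combine = All.tabulate λ c∈ → from (∈-++⁻ (map rest (filter vanishing? L)) c∈)
      where
      from : ∀ {c} → c ∈ map rest (filter vanishing? L)
                   ⊎ c ∈ cartesianProductWith combine (filter positive? L) (filter negative? L) → A c
      from (inj₁ c∈) with _ , c′∈ , ≡.refl ← ∈-map⁻ rest c∈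
                     with c′∈L , v ← ∈-filter⁻ vanishing? c′∈ = A-rest c′∈L v
      from (inj₂ c∈)
        with _ , _ , p∈ , q∈ , ≡.refl ← ∈-cartesianProductWith⁻ combine (filter positive? L) (filter negative? L) c∈
        with p∈L , 0<p ← ∈-filter⁻ positive? p∈
        with q∈L , q<0 ← ∈-filter⁻ negative? q∈ = A-combine p∈L q∈L 0<p q<0

    rest∈eliminate : ∀ {L c} → c ∈ L → Vanishing c → rest c ∈ eliminate L
    rest∈eliminate c∈L v = ∈-++⁺ˡ (∈-map⁺ rest (∈-filter⁺ vanishing? c∈L v))

    combine∈eliminate : ∀ {L p q} → p ∈ L → q ∈ L → Positive p → Negative q → combine p q ∈ eliminate L
    combine∈eliminate {L} p∈L q∈L 0<p q<0 = ∈-++⁺ʳ (map rest (filter vanishing? L))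
      (∈-cartesianProductWith⁺ combine (∈-filter⁺ positive? p∈L 0<p) (∈-filter⁺ negative? q∈L q<0))

    value-∷ : ∀ c t x l → value c (t ∷ᵛ x) l ≈ leading c * t + value (rest c) x l
    value-∷ c t x l = +-assoc (leading c * t) ⟨ coefficients (rest c) , x ⟩ (slope c * l + constant c)

    value-combine : ∀ p q x l → value (combine p q) x l ≈
                    - leading q * value (rest p) x l + leading p * value (rest q) x l
    value-combine p q x l = begin-equality
      value (combine p q) x l
        ≈⟨ +-congʳ (⟨⟩-linearˡ u v (tail (coefficients p)) (tail (coefficients q)) x) ⟩
      u * a + v * b + ((u * slope p + v * slope q) * l + (u * constant p + v * constant q))
        ≈⟨ solve 9 (λ u v a b s t c d l → u :* a :+ v :* b :+ ((u :* s :+ v :* t) :* l :+ (u :* c :+ v :* d))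
                      := u :* (a :+ (s :* l :+ c)) :+ v :* (b :+ (t :* l :+ d)))
                 refl u v a b (slope p) (slope q) (constant p) (constant q) l ⟩
      u * value (rest p) x l + v * value (rest q) x l ∎
      where
      u = - leading q
      v = leading p
      a = ⟨ coefficients (rest p) , x ⟩
      b = ⟨ coefficients (rest q) , x ⟩

    negative⇒0<- : ∀ c → Negative c → 0# < - leading c
    negative⇒0<- c c<0 = ≰⇒> λ -c≤0 → c<0
      (≤-trans (neg-nonneg -c≤0) (≤-reflexive (-‿involutive _)))

    eliminate-monotone : ∀ {L} → MonotoneSystem L → MonotoneSystem (eliminate L)
    eliminate-monotone {L} mono = eliminate⁺ L
      (λ c∈L _ → All.lookup mono c∈L)
      (λ {p} {q} p∈L q∈L 0<p q<0 → +-nonneg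
        (*-nonneg (proj₁ (negative⇒0<- q q<0)) (All.lookup mono p∈L))
        (*-nonneg (proj₁ (≰⇒> 0<p)) (All.lookup mono q∈L)))

    -- A combination of two valid inequalities with positive multipliers is valid, and its terms in
    -- t cancel.
    eliminate-sound : ∀ {L t x l} → Satisfies L (t ∷ᵛ x) l → Satisfies (eliminate L) x l
    eliminate-sound {L} {t} {x} {l} sat = eliminate⁺ L
      (λ {c} c∈L c≈0 → begin
        0#                                 ≤⟨ All.lookup sat c∈L ⟩
        value c (t ∷ᵛ x) l                 ≈⟨ value-∷ c t x l ⟩
        leading c * t + value (rest c) x l ≈⟨ +-congʳ (trans (*-congʳ c≈0) (zeroˡ t)) ⟩
        0# + value (rest c) x l            ≈⟨ +-identityˡ _ ⟩
        value (rest c) x l                 ∎)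
      (λ {p} {q} p∈L q∈L 0<p q<0 → let u = - leading q; v = leading p; e = value (rest p) x l; f = value (rest q) x l in begin
        0#                                                ≤⟨ +-nonneg
                                                               (*-nonneg (proj₁ (negative⇒0<- q q<0)) (All.lookup sat p∈L))
                                                               (*-nonneg (proj₁ (≰⇒> 0<p)) (All.lookup sat q∈L)) ⟩
        u * value p (t ∷ᵛ x) l + v * value q (t ∷ᵛ x) l   ≈⟨ +-cong (*-congˡ (value-∷ p t x l)) (*-congˡ (value-∷ q t x l)) ⟩
        u * (v * t + e) + v * (leading q * t + f)         ≈⟨ solve 6 (λ u v w t e f → u :* (v :* t :+ e) :+ v :* (w :* t :+ f)
                                                                        := (u :+ w) :* (v :* t) :+ (u :* e :+ v :* f))
                                                                   refl u v (leading q) t e f ⟩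
        (u + leading q) * (v * t) + (u * e + v * f)       ≈⟨ +-congʳ (trans (*-congʳ (-‿inverseˡ (leading q))) (zeroˡ _)) ⟩
        0# + (u * e + v * f)                              ≈⟨ +-identityˡ _ ⟩
        u * e + v * f                                     ≈⟨ value-combine p q x l ⟨
        value (combine p q) x l                           ∎)

  -- The zero of t ↦ a t + e; the value is junk when a ≈ 0#.
  zeroOf : Carrier → Carrier → Carrier
  zeroOf a e with a ≟ 0#
  ... | yes _   = 0#
  ... | no  a≉0 = proj₁ (inverse a≉0) * - e

  zeroOf-correct : ∀ {a} e → ¬ a ≈ 0# → a * zeroOf a e + e ≈ 0#
  zeroOf-correct {a} e a≉0 with a ≟ 0#
  ... | yes a≈0  = contradiction a≈0 a≉0
  ... | no  a≉0′ = begin-equality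
    a * (a⁻¹ * - e) + e   ≈⟨ +-congʳ (*-assoc a a⁻¹ (- e)) ⟨
    a * a⁻¹ * - e + e     ≈⟨ +-congʳ (*-congʳ (proj₂ (inverse a≉0′))) ⟩
    1# * - e + e          ≈⟨ +-congʳ (*-identityˡ (- e)) ⟩
    - e + e               ≈⟨ -‿inverseˡ e ⟩
    0#                    ∎
    where a⁻¹ = proj₁ (inverse a≉0′)

  -- The maximum of the lower bounds separates. Without lower bounds any number below all of `us`
  -- will do; the default `0#` covers the case that `us` is empty as well.
  between : ∀ ls us → (∀ {l u} → l ∈ ls → u ∈ us → l ≤ u) →
            ∃ λ t → All (_≤ t) ls × All (t ≤_) us
  between []       us ls≤us = min 0# us , [] , min≤xs 0# us
  between (l ∷ ls) us ls≤us = max l ls , ⊥≤max l ls ∷ xs≤max l ls ,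
    All.tabulate λ u∈us → max≤v⁺ (ls≤us (here ≡.refl) u∈us) (All.tabulate λ l∈ls → ls≤us (there l∈ls) u∈us)

  module _ {n : ℕ} (L : List (Constraint (suc n))) (x : Point n) (l : Carrier) where

    -- The first coordinate at which the constraint becomes tight for the fixed x and l, provided
    -- that its leading coefficient is nonzero.
    bound : Constraint (suc n) → Carrier
    bound c = zeroOf (leading c) (value (rest c) x l)

    bound-correct : ∀ c → ¬ Vanishing c → leading c * bound c + value (rest c) x l ≈ 0#
    bound-correct c = zeroOf-correct (value (rest c) x l)

    positive⇒≉0 : ∀ c → Positive c → ¬ Vanishing {n} c
    positive⇒≉0 c 0<c c≈0 = 0<c (≤-reflexive c≈0)

    negative⇒≉0 : ∀ c → Negative c → ¬ Vanishing {n} c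
    negative⇒≉0 c c<0 c≈0 = c<0 (≤-reflexive (sym c≈0))

    -- The combined constraint says 0 ≤ b e + a f. Tightness gives e = - a s and f = b t, so it
    -- reads a b s ≤ a b t, and a b is positive.
    bound-≤ : Satisfies (eliminate L) x l → ∀ {p q} → p ∈ L → q ∈ L → Positive p → Negative q →
              bound p ≤ bound q
    bound-≤ sat {p} {q} p∈L q∈L 0<p q<0 = Reciprocal.*-cancelˡ-≤ (*-pos (≰⇒> 0<p) (negative⇒0<- q q<0)) (begin
      a * b * s                        ≤⟨ x≤x+y (≤-trans (All.lookup sat (combine∈eliminate p∈L q∈L 0<p q<0))
                                                          (≤-reflexive (value-combine p q x l))) ⟩
      a * b * s + (b * e + a * f)      ≈⟨ solve 5 (λ a b s e f → a :* b :* s :+ (b :* e :+ a :* f)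
                                                     := b :* (a :* s :+ e) :+ a :* f) refl a b s e f ⟩
      b * (a * s + e) + a * f          ≈⟨ +-cong (trans (*-congˡ (bound-correct p (positive⇒≉0 p 0<p))) (zeroʳ b)) (*-congˡ f≈bt) ⟩
      0# + a * (b * t)                 ≈⟨ +-identityˡ _ ⟩
      a * (b * t)                      ≈⟨ *-assoc a b t ⟨
      a * b * t                        ∎)
      where
      a = leading p
      b = - leading q
      s = bound p
      t = bound q
      e = value (rest p) x l
      f = value (rest q) x l
      f≈bt : f ≈ b * t
      f≈bt = begin-equality
        f                             ≈⟨ +-identityˡ f ⟨
        0# + f                        ≈⟨ +-congʳ (trans (*-congʳ (-‿inverseˡ (leading q))) (zeroˡ t)) ⟨
        (b + leading q) * t + f       ≈⟨ solve 4 (λ b w t f → (b :+ w) :* t :+ f := b :* t :+ (w :* t :+ f)) refl b (leading q) t f ⟩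
        b * t + (leading q * t + f)   ≈⟨ +-congˡ (bound-correct q (negative⇒≉0 q q<0)) ⟩
        b * t + 0#                    ≈⟨ +-identityʳ (b * t) ⟩
        b * t                         ∎

    -- By `bound-≤` every lower bound on the first coordinate is below every upper bound, so some t
    -- lies between them all.
    eliminate-complete : Satisfies (eliminate L) x l → ∃ λ t → Satisfies L (t ∷ᵛ x) l
    eliminate-complete sat = t , All.tabulate λ {c} c∈L → ≤-trans (holds c∈L) (≤-reflexive (sym (value-∷ c t x l)))
      where
      lowers = map bound (filter positive? L)
      uppers = map bound (filter negative? L)

      lowers≤uppers : ∀ {s u} → s ∈ lowers → u ∈ uppers → s ≤ u
      lowers≤uppers s∈ u∈
        with p , p∈ , ≡.refl ← ∈-map⁻ bound s∈
        with q , q∈ , ≡.refl ← ∈-map⁻ bound u∈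
        with p∈L , 0<p ← ∈-filter⁻ positive? p∈
        with q∈L , q<0 ← ∈-filter⁻ negative? q∈ = bound-≤ sat p∈L q∈L 0<p q<0

      separating = between lowers uppers lowers≤uppers

      t : Carrier
      t = proj₁ separating

      holds : ∀ {c} → c ∈ L → 0# ≤ leading c * t + value (rest c) x l
      holds {c} c∈L with leading c ≟ 0# | total 0# (leading c)
      ... | yes c≈0 | _ = begin
        0#                                  ≤⟨ All.lookup sat (rest∈eliminate c∈L c≈0) ⟩
        value (rest c) x l                  ≈⟨ +-identityˡ _ ⟨
        0# + value (rest c) x l             ≈⟨ +-congʳ (trans (*-congʳ c≈0) (zeroˡ t)) ⟨
        leading c * t + value (rest c) x l  ∎
      -- The constraint is affine and increasing in the first coordinate and zero at `bound c`,
      -- which lies below t. The next case is its mirror image.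
      ... | no c≉0 | inj₁ 0≤c = begin
        0#                                        ≈⟨ bound-correct c c≉0 ⟨
        leading c * bound c + value (rest c) x l  ≤⟨ +-mono-≤ (*-monoʳ-≤ 0≤c bound≤t) ≤-refl ⟩
        leading c * t + value (rest c) x l        ∎
        where
        bound≤t : bound c ≤ t
        bound≤t = All.lookup (proj₁ (proj₂ separating))
          (∈-map⁺ bound (∈-filter⁺ positive? c∈L (λ c≤0 → c≉0 (≤-antisym c≤0 0≤c))))
      ... | no c≉0 | inj₂ c≤0 = begin
        0#                                        ≈⟨ bound-correct c c≉0 ⟨
        leading c * bound c + value (rest c) x l  ≤⟨ +-mono-≤ (*-antimonoʳ-≤ c≤0 t≤bound) ≤-refl ⟩
        leading c * t + value (rest c) x l        ∎
        where
        t≤bound : t ≤ bound c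
        t≤bound = All.lookup (proj₂ (proj₂ separating))
          (∈-map⁺ bound (∈-filter⁺ negative? c∈L (λ 0≤c → c≉0 (≤-antisym c≤0 0≤c))))

  -- The condition 0 ≤ l keeps the set bounded below even when the system puts no lower bound on l.
  Attainable : ∀ {n} → List (Constraint n) → Carrier → Set
  Attainable {n} L l = 0# ≤ l × ∃ λ (x : Point n) → Satisfies L x l

  value≈constant : ∀ (c : Constraint zero) x l → slope c ≈ 0# → value c x l ≈ constant c
  value≈constant c x l s≈0 =
    trans (+-identityˡ _) (trans (+-congʳ (trans (*-congʳ s≈0) (zeroˡ l))) (+-identityˡ _))

  -- Nonnegative slopes make the solution set of a system without variables
  -- empty or a closed ray.
  ray : (L : List (Constraint zero)) → MonotoneSystem L → (x : Point zero) →
        (∀ {l} → ¬ (0# ≤ l × Satisfies L x l)) ⊎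
        (∃ λ m → 0# ≤ m × (∀ {l} → m ≤ l → Satisfies L x l) × (∀ {l} → 0# ≤ l → Satisfies L x l → m ≤ l))
  ray []      []            x = inj₂ (0# , ≤-refl , (λ _ → []) , λ 0≤l _ → 0≤l)
  ray (c ∷ L) (0≤s ∷ mono)  x with ray L mono x
  ... | inj₁ ∄l = inj₁ λ { (0≤l , _ ∷ sat) → ∄l (0≤l , sat) }
  ... | inj₂ (m , 0≤m , m≤⇒sat , sat⇒m≤) with slope c ≟ 0#
  -- A positive slope s turns the constraint into l ≥ - `constant c` / s, so the endpoint moves to
  -- the larger of m and this bound.
  ...   | no s≉0 = inj₂ (max m (b ∷ []) , ≤-trans 0≤m m≤max , max≤⇒sat , sat⇒max≤)
    where
    s = slope c
    b = zeroOf s (constant c)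
    m≤max = ⊥≤max m (b ∷ [])
    b≤max : b ≤ max m (b ∷ [])
    b≤max = All.head (xs≤max m (b ∷ []))
    max≤⇒sat : ∀ {l} → max m (b ∷ []) ≤ l → Satisfies (c ∷ L) x l
    max≤⇒sat {l} max≤l = (begin
      0#                        ≈⟨ zeroOf-correct (constant c) s≉0 ⟨
      s * b + constant c        ≤⟨ +-mono-≤ (*-monoʳ-≤ 0≤s (≤-trans b≤max max≤l)) ≤-refl ⟩
      s * l + constant c        ≈⟨ +-identityˡ _ ⟨
      0# + (s * l + constant c) ∎) ∷ m≤⇒sat (≤-trans m≤max max≤l)
    sat⇒max≤ : ∀ {l} → 0# ≤ l → Satisfies (c ∷ L) x l → max m (b ∷ []) ≤ l
    sat⇒max≤ {l} 0≤l (h ∷ sat) = max≤v⁺ (sat⇒m≤ 0≤l sat) (b≤l ∷ [])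
      where
      b≤l : b ≤ l
      b≤l = Reciprocal.*-cancelˡ-≤ (0≤s , λ 0≈s → s≉0 (sym 0≈s)) (+-cancelˡ-≤ (constant c) (begin
        constant c + s * b        ≈⟨ +-comm _ _ ⟩
        s * b + constant c        ≈⟨ zeroOf-correct (constant c) s≉0 ⟩
        0#                        ≤⟨ h ⟩
        0# + (s * l + constant c) ≈⟨ +-identityˡ _ ⟩
        s * l + constant c        ≈⟨ +-comm _ _ ⟩
        constant c + s * l        ∎))
  -- With slope zero the constraint does not involve l: it either changes nothing or empties the
  -- set.
  ...   | yes s≈0 with 0# ≤? constant c
  ...     | yes 0≤k = inj₂ (m , 0≤m , (λ {l} m≤l → ≤-trans 0≤k (≤-reflexive (sym (value≈constant c x l s≈0))) ∷ m≤⇒sat m≤l) ,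
                            λ { 0≤l (_ ∷ sat) → sat⇒m≤ 0≤l sat })
  ...     | no 0≰k = inj₁ λ { {l} (_ , h ∷ _) → 0≰k (≤-trans h (≤-reflexive (value≈constant c x l s≈0))) }

  -- Eliminating a variable changes neither the attainable parameters nor the signs of the slopes.
  -- Once no variable is left, the endpoint of the ray is the minimum.
  attainable-least : ∀ {n} (L : List (Constraint n)) → MonotoneSystem L → EmptyOrLeast (Attainable L)
  attainable-least {zero} L mono with ray L mono (λ ())
  ... | inj₁ ∄l = inj₁ λ { (0≤l , _ , sat) → ∄l (0≤l , sat) }
  ... | inj₂ (m , 0≤m , m≤⇒sat , sat⇒m≤) =
    inj₂ (m , (0≤m , (λ ()) , m≤⇒sat ≤-refl) , λ { (0≤l , _ , sat) → sat⇒m≤ 0≤l sat })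
  attainable-least {suc n} L mono = emptyOrLeast-resp
    (λ { {l} (0≤l , x , sat) → let t , sat′ = eliminate-complete L x l sat in 0≤l , (t ∷ᵛ x) , sat′ })
    (λ { (0≤l , x , sat) → 0≤l , tail x , eliminate-sound {t = head x} {x = tail x} sat })
    (attainable-least (eliminate L) (eliminate-monotone mono))

-- Maxima of inner products, and systems that express the ratio ω(x , Q) / ω(x , P).

module RegretProperties (ℝ : Reals) {d : ℕ} (P : Regret.PointSet ℝ d) where

  open Reals ℝ hiding (zero)
  open Regret ℝ
  open PointSet P
  open OrderedField ℝ
  open InnerProduct ℝ
  open Optimisation ℝ
  open Extrema totalOrder using (xs≤max; argmax-sel)
  open AddSupremum _≤_ using (_≤⁺_; [_])
  open ≤-Reasoning poset

  ∈-elements⁺ : ∀ {Q : Subset size} {i} → i ∈ˢ Q → i ∈ elements Q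
  ∈-elements⁺ {Q} {i} i∈Q = ∈-filter⁺ (_∈? Q) (∈-allFin i) i∈Q

  ∈-elements⁻ : ∀ {Q : Subset size} {i} → i ∈ elements Q → i ∈ˢ Q
  ∈-elements⁻ {Q} i∈ = proj₂ (∈-filter⁻ (_∈? Q) {xs = allFin size} i∈)

  ⟨i,x⟩≤ω : ∀ i x Q Q≠∅ → i ∈ˢ Q → ⟨ point i , x ⟩ ≤ ω P x Q Q≠∅
  ⟨i,x⟩≤ω i x Q (j , _) i∈Q =
    All.lookup (xs≤max ⟨ point j , x ⟩ _) (∈-map⁺ (λ i → ⟨ point i , x ⟩) (∈-elements⁺ i∈Q))

  -- A list maximum is its default or a list member, and here the default is itself a value at a
  -- point of Q.
  ω-attained : ∀ x Q Q≠∅ → ∃ λ i → i ∈ˢ Q × ω P x Q Q≠∅ ≡ ⟨ point i , x ⟩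
  ω-attained x Q (j , j∈Q) with argmax-sel id ⟨ point j , x ⟩ (map (λ i → ⟨ point i , x ⟩) (elements Q))
  ... | inj₁ ω≡ = j , j∈Q , ω≡
  ... | inj₂ ω∈ with i , i∈ , ω≡ ← ∈-map⁻ (λ i → ⟨ point i , x ⟩) ω∈ = i , ∈-elements⁻ i∈ , ω≡

  ω≤⁺ : ∀ x Q Q≠∅ {b} → (∀ {i} → i ∈ˢ Q → ⟨ point i , x ⟩ ≤ b) → ω P x Q Q≠∅ ≤ b
  ω≤⁺ x Q Q≠∅ ≤b with i , i∈Q , ω≡ ← ω-attained x Q Q≠∅ = ≡.subst (_≤ _) (≡.sym ω≡) (≤b i∈Q)

  sphere⇒≉𝟎 : ∀ {x : Point d} → Sphere x → ¬ x ≋ 𝟎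
  sphere⇒≉𝟎 {x} ⟨x,x⟩≈1 x≋𝟎 = 0≉1 (trans (sym (⟨⟩-zeroʳ x x x≋𝟎)) ⟨x,x⟩≈1)

  -- These say 0 ≤ ⟨ p , x ⟩ - 1 and 0 ≤ l - ⟨ q , x ⟩ for q ∈ Q. Requiring 1 ≤ ⟨ p , x ⟩ replaces
  -- the normalisation ω(x , P) = 1, which is not linear.
  system : Subset size → Fin size → List (Constraint d)
  system Q p = constraint (point p) 0# (- 1#)
             ∷ map (λ q → constraint (λ k → - point q k) 1# 0#) (elements Q)

  system-monotone : ∀ Q p → MonotoneSystem (system Q p)
  system-monotone Q p = ≤-refl ∷ All.tabulate slope≥0
    where
    slope≥0 : ∀ {c} → c ∈ map (λ q → constraint (λ k → - point q k) 1# 0#) (elements Q) → 0# ≤ Constraint.slope c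
    slope≥0 c∈ with _ , _ , ≡.refl ← ∈-map⁻ _ c∈ = 0≤1

  lower-value : ∀ p x l → value (constraint (point p) 0# (- 1#)) x l ≈ ⟨ point p , x ⟩ - 1#
  lower-value p x l = +-congˡ (trans (+-congʳ (zeroˡ l)) (+-identityˡ (- 1#)))

  upper-value : ∀ q x l → value (constraint (λ k → - point q k) 1# 0#) x l ≈ l - ⟨ point q , x ⟩
  upper-value q x l = begin-equality
    ⟨ (λ k → - point q k) , x ⟩ + (1# * l + 0#)  ≈⟨ +-cong (⟨⟩-negˡ (point q) x) (trans (+-identityʳ _) (*-identityˡ l)) ⟩
    - ⟨ point q , x ⟩ + l                        ≈⟨ +-comm _ l ⟩
    l - ⟨ point q , x ⟩                          ∎

  system⁺ : ∀ {Q p x l} → 1# ≤ ⟨ point p , x ⟩ → (∀ {q} → q ∈ˢ Q → ⟨ point q , x ⟩ ≤ l) →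
            Satisfies (system Q p) x l
  system⁺ {Q} {p} {x} {l} 1≤p q≤l =
    ≤-trans (x≤y⇒0≤y-x 1≤p) (≤-reflexive (sym (lower-value p x l))) ∷ All.tabulate upper
    where
    upper : ∀ {c} → c ∈ map (λ q → constraint (λ k → - point q k) 1# 0#) (elements Q) → 0# ≤ value c x l
    upper c∈ with q , q∈ , ≡.refl ← ∈-map⁻ _ c∈ =
      ≤-trans (x≤y⇒0≤y-x (q≤l (∈-elements⁻ q∈))) (≤-reflexive (sym (upper-value q x l)))

  system⁻ : ∀ {Q p x l} → Satisfies (system Q p) x l →
            1# ≤ ⟨ point p , x ⟩ × (∀ {q} → q ∈ˢ Q → ⟨ point q , x ⟩ ≤ l)
  system⁻ {Q} {p} {x} {l} (lower ∷ uppers) =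
    0≤y-x⇒x≤y (≤-trans lower (≤-reflexive (lower-value p x l))) ,
    λ {q} q∈Q → 0≤y-x⇒x≤y (≤-trans (All.lookup uppers (∈-map⁺ _ (∈-elements⁺ q∈Q))) (≤-reflexive (upper-value q x l)))

  -- The minimal ratio and the maximal regret.

  module _ (standing : StandingCondition P) where

    open Reciprocal

    -- By definition `regretRatio` is 1 minus this ratio, so a minimiser here is a maximiser of the
    -- regret.
    ratio : (Q : Subset size) → Nonempty Q → ∃ Sphere → Carrier
    ratio Q Q≠∅ (x , x∈S) = ω P x Q Q≠∅ * recip (standing x x∈S)

    ratio≤⁺ : ∀ {Q Q≠∅ x∈S b} → ω P (proj₁ x∈S) Q Q≠∅ ≤ b * ωP P (proj₁ x∈S) → ratio Q Q≠∅ x∈S ≤ b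
    ratio≤⁺ {Q} {Q≠∅} {x , x∈S} {b} ω≤b*ωP = begin
      ω P x Q Q≠∅ * recip 0<ωP   ≤⟨ *-monoˡ-≤ (0≤recip 0<ωP) ω≤b*ωP ⟩
      b * ωP P x * recip 0<ωP    ≈⟨ *-assoc _ _ _ ⟩
      b * (ωP P x * recip 0<ωP)  ≈⟨ *-congˡ (x*recip≈1 0<ωP) ⟩
      b * 1#                     ≈⟨ *-identityʳ b ⟩
      b                          ∎
      where 0<ωP = standing x x∈S

    ≤ratio⁺ : ∀ {Q Q≠∅ x∈S b} → b * ωP P (proj₁ x∈S) ≤ ω P (proj₁ x∈S) Q Q≠∅ → b ≤ ratio Q Q≠∅ x∈S
    ≤ratio⁺ {Q} {Q≠∅} {x , x∈S} {b} b*ωP≤ω = begin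
      b                          ≈⟨ *-identityʳ b ⟨
      b * 1#                     ≈⟨ *-congˡ (x*recip≈1 0<ωP) ⟨
      b * (ωP P x * recip 0<ωP)  ≈⟨ *-assoc _ _ _ ⟨
      b * ωP P x * recip 0<ωP    ≤⟨ *-monoˡ-≤ (0≤recip 0<ωP) b*ωP≤ω ⟩
      ω P x Q Q≠∅ * recip 0<ωP   ∎
      where 0<ωP = standing x x∈S

    -- Scale x by 1 / ω(x , P) and let p attain ω(x , P): the pairing with p becomes 1 and the
    -- maximum over Q becomes the ratio.
    ratio-attainable : ∀ {Q} Q≠∅ x∈S → 0# ≤ ratio Q Q≠∅ x∈S →
                       ∃ λ p → Attainable (system Q p) (ratio Q Q≠∅ x∈S)
    ratio-attainable {Q} Q≠∅ (x , x∈S) 0≤ratio with p , _ , ωP≡ ← ω-attained x ⊤ nonempty =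
      p , 0≤ratio , c · x , system⁺ {x = c · x} (≤-reflexive (begin-equality
        1#                     ≈⟨ recip*x≈1 0<ωP ⟨
        c * ωP P x             ≡⟨ ≡.cong (c *_) ωP≡ ⟩
        c * ⟨ point p , x ⟩    ≈⟨ ⟨⟩-·ʳ c (point p) x ⟨
        ⟨ point p , c · x ⟩    ∎))
      λ {q} q∈Q → begin
        ⟨ point q , c · x ⟩    ≈⟨ ⟨⟩-·ʳ c (point q) x ⟩
        c * ⟨ point q , x ⟩    ≤⟨ *-monoʳ-≤ (0≤recip 0<ωP) (⟨i,x⟩≤ω q x Q Q≠∅ q∈Q) ⟩
        c * ω P x Q Q≠∅        ≈⟨ *-comm c _ ⟩
        ω P x Q Q≠∅ * c        ∎
      where
      0<ωP = standing x x∈S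
      c = recip 0<ωP

    -- For the normalised solution c y, ω(c y , Q) ≤ c m ≤ m ⟨ p , c y ⟩ ≤ m ω(c y , P); the last
    -- two steps use 0 ≤ m.
    attainable⇒ratio≤ : ∀ {Q} Q≠∅ {p m} → Attainable (system Q p) m → ∃ λ u∈S → ratio Q Q≠∅ u∈S ≤ m
    attainable⇒ratio≤ {Q} Q≠∅ {p} {m} (0≤m , y , sat) = rescaled (normalise (point p) y 1≤p)
      where
      1≤p = proj₁ (system⁻ {Q} {p} {y} {m} sat)
      q≤m = proj₂ (system⁻ {Q} {p} {y} {m} sat)
      rescaled : (∃ λ c → 0# < c × Sphere (c · y)) → ∃ λ u∈S → ratio Q Q≠∅ u∈S ≤ m
      rescaled (c , (0≤c , _) , cy∈S) =
        (c · y , cy∈S) , ratio≤⁺ {Q} {Q≠∅} {c · y , cy∈S} {m} (ω≤⁺ (c · y) Q Q≠∅ {m * ωP P (c · y)} λ {q} q∈Q → begin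
          ⟨ point q , c · y ⟩        ≈⟨ ⟨⟩-·ʳ c (point q) y ⟩
          c * ⟨ point q , y ⟩        ≤⟨ *-monoʳ-≤ 0≤c (q≤m q∈Q) ⟩
          c * m                      ≈⟨ *-comm c m ⟩
          m * c                      ≈⟨ *-congˡ (*-identityʳ c) ⟨
          m * (c * 1#)               ≤⟨ *-monoʳ-≤ 0≤m (*-monoʳ-≤ 0≤c 1≤p) ⟩
          m * (c * ⟨ point p , y ⟩)  ≈⟨ *-congˡ (⟨⟩-·ʳ c (point p) y) ⟨
          m * ⟨ point p , c · y ⟩    ≤⟨ *-monoʳ-≤ 0≤m (⟨i,x⟩≤ω p (c · y) ⊤ nonempty ∈⊤) ⟩
          m * ωP P (c · y)           ∎)

    -- The least m attainable for some p is below every ratio, and its solution yields a unit vector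
    -- with ratio at most m. Nonnegativity places the ratios among the attainable values.
    ratio-minimum : ∀ {Q} Q≠∅ → ∃ Sphere → (∀ x∈S → 0# ≤ ratio Q Q≠∅ x∈S) →
                    ∃ λ u∈S → ∀ x∈S → ratio Q Q≠∅ u∈S ≤ ratio Q Q≠∅ x∈S
    ratio-minimum {Q} Q≠∅ x₀ 0≤ratio =
      minimum (emptyOrLeast-∃ (λ p → attainable-least (system Q p) (system-monotone Q p)))
      where
      minimum : EmptyOrLeast (λ l → ∃ λ p → Attainable (system Q p) l) →
                ∃ λ u∈S → ∀ x∈S → ratio Q Q≠∅ u∈S ≤ ratio Q Q≠∅ x∈S
      minimum (inj₁ ∄l) = contradiction (ratio-attainable Q≠∅ x₀ (0≤ratio x₀)) ∄l
      minimum (inj₂ (m , (p , att) , m≤)) = proj₁ bounded , λ x∈S →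
        ≤-trans (proj₂ bounded) (m≤ (ratio-attainable Q≠∅ x∈S (0≤ratio x∈S)))
        where bounded = attainable⇒ratio≤ Q≠∅ {p} {m} att

    -- Domination bounds every ratio below by 1 - ε ≥ 0, so a minimiser exists, and the regret there
    -- is at most ε.
    isRegretSet⁺ : ∀ {ε Q} → Nonempty Q → ∃ Sphere → ε ≤ 1# →
                   (∀ x → Sphere x → ∃ λ i → i ∈ˢ Q × (1# - ε) * ωP P x ≤ ⟨ point i , x ⟩) →
                   IsRegretSet P standing ε Q
    isRegretSet⁺ {ε} {Q} Q≠∅ x₀ ε≤1 dominates =
      Q≠∅ , regretRatio P standing Q Q≠∅ u∈S , ((u∈S , tt , refl) , λ x∈S _ → +-monoʳ-≤ 1# (neg-mono-≤ (u-minimal x∈S))) ,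
      x-y≤z⇒x-z≤y (1-ε≤ratio u∈S)
      where
      1-ε≤ratio : ∀ x∈S → 1# - ε ≤ ratio Q Q≠∅ x∈S
      1-ε≤ratio (x , x∈S) with i , i∈Q , ≤i ← dominates x x∈S =
        ≤ratio⁺ {Q} {Q≠∅} {x , x∈S} (≤-trans ≤i (⟨i,x⟩≤ω i x Q Q≠∅ i∈Q))
      minimum = ratio-minimum Q≠∅ x₀ λ x∈S → ≤-trans (x≤y⇒0≤y-x ε≤1) (1-ε≤ratio x∈S)
      u∈S = proj₁ minimum
      u-minimal = proj₂ minimum

  -- Correctness of the graph search and of the greedy cover.

  module _ (X : Subset size) (N : Fin size → Subset size) (ε : Carrier) where

    open HGRMR P X N ε

    -- Only `accept` adds an edge, and its premises are the claimed certificate. A search started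
    -- without edges leaves only the second alternative.
    search-sound : ∀ {i q V E E′} → Search i q V E E′ → ∀ {j} → j ∈ˢ E′ →
                   j ∈ˢ E ⊎ (∃ λ e → IsOptimalValue i j e × e ≤⁺ [ ε ])
    search-sound done           j∈E′ = inj₁ j∈E′
    search-sound (skip _ s)     j∈E′ = search-sound s j∈E′
    search-sound (reject _ _ _ s) j∈E′ = search-sound s j∈E′
    search-sound {E = E} (accept {j = k} {e = e} _ opt e≤ε _ s) j∈E′ with search-sound s j∈E′
    ... | inj₂ found = inj₂ found
    ... | inj₁ j∈E∪k with x∈p∪q⁻ E _ j∈E∪k
    ...   | inj₁ j∈E = inj₁ j∈E
    ...   | inj₂ j∈k with ≡.refl ← x∈⁅y⁆⇒x≡y k j∈k = inj₂ (e , opt , e≤ε)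

    module _ (H : Fin size → Subset size) where

      greedy-extends : ∀ {Q W Q′} → Greedy H Q W Q′ → Q ⊆ˢ Q′
      greedy-extends (done _)           i∈Q = i∈Q
      greedy-extends (pick t _ _ _ _ g) i∈Q = greedy-extends g (x∈p∪q⁺ (inj₁ i∈Q))

      -- The loop stops only when nothing is uncovered, a point leaves `W` only through `Dom` of a
      -- picked point, and picked points are kept.
      greedy-covers : ∀ {Q W Q′} → Greedy H Q W Q′ → ∀ {j} → j ∈ˢ W →
                      ∃ λ i → i ∈ˢ X × i ∈ˢ Q′ × j ∈ˢ Dom H i
      greedy-covers (done W≡∅) {j} j∈W = contradiction (j , j∈W) W≡∅
      greedy-covers (pick t _ t∈X _ _ g) {j} j∈W with j ∈? Dom H t
      ... | yes j∈Dom = t , t∈X , greedy-extends g (x∈p∪q⁺ (inj₂ (x∈⁅x⁆ t))) , j∈Dom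
      ... | no  j∉Dom = greedy-covers g (x∈p∧x∉q⇒x∈p─q j∈W j∉Dom)

    -- The vector x / ω(x , P) is feasible for j, so its objective 1 - ⟨ i , x ⟩ / ω(x , P) is at
    -- most v ≤ ε; multiply by ω(x , P).
    optimum⇒dominates : ∀ {i j x v} → IsMaximum (Feasible j) (objective i) v → v ≤ ε →
                        0# < ωP P x → ωP P x ≡ ⟨ point j , x ⟩ → (1# - ε) * ωP P x ≤ ⟨ point i , x ⟩
    optimum⇒dominates {i} {j} {x} {v} (_ , ≤v) v≤ε 0<ωP ωP≡ = begin
      (1# - ε) * ωP P x              ≤⟨ *-monoˡ-≤ (proj₁ 0<ωP) (x-y≤z⇒x-z≤y (≤-trans (≤v (c · x) feasible) v≤ε)) ⟩
      ⟨ point i , c · x ⟩ * ωP P x   ≈⟨ *-comm _ _ ⟩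
      ωP P x * ⟨ point i , c · x ⟩   ≈⟨ *-congˡ (⟨⟩-·ʳ c (point i) x) ⟩
      ωP P x * (c * ⟨ point i , x ⟩) ≈⟨ x*[recip*y]≈y 0<ωP _ ⟩
      ⟨ point i , x ⟩                ∎
      where
      open Reciprocal
      c = recip 0<ωP
      feasible : Feasible j (c · x)
      -- Since j attains ω(x , P), no neighbour t has a larger inner product with x, and the scaling
      -- makes the pairing with j equal to 1.
      feasible = (λ t _ → +-cancelˡ-≤ ⟨ point t , c · x ⟩ (begin
          ⟨ point t , c · x ⟩ + 0#                             ≈⟨ +-identityʳ _ ⟩
          ⟨ point t , c · x ⟩                                  ≈⟨ ⟨⟩-·ʳ c (point t) x ⟩
          c * ⟨ point t , x ⟩                                  ≤⟨ *-monoʳ-≤ (0≤recip 0<ωP) (⟨i,x⟩≤ω t x ⊤ nonempty ∈⊤) ⟩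
          c * ωP P x                                           ≡⟨ ≡.cong (c *_) ωP≡ ⟩
          c * ⟨ point j , x ⟩                                  ≈⟨ ⟨⟩-·ʳ c (point j) x ⟨
          ⟨ point j , c · x ⟩                                  ≈⟨ ⟨⟩-⊝ˡ (point j) (point t) (c · x) ⟨
          ⟨ point j ⊝ point t , c · x ⟩ + ⟨ point t , c · x ⟩  ≈⟨ +-comm _ _ ⟩
          ⟨ point t , c · x ⟩ + ⟨ point j ⊝ point t , c · x ⟩  ∎)) ,
        (begin-equality
          ⟨ point j , c · x ⟩  ≈⟨ ⟨⟩-·ʳ c (point j) x ⟩
          c * ⟨ point j , x ⟩  ≡⟨ ≡.cong (c *_) ωP≡ ⟨
          c * ωP P x           ≈⟨ recip*x≈1 0<ωP ⟩
          1#                   ∎)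

    returned-dominates : StandingCondition P → IsExtremeSet P X → 0# ≤ ε → ∀ {Q} → Returns Q →
                         ∀ x → Sphere x → ∃ λ i → i ∈ˢ Q × (1# - ε) * ωP P x ≤ ⟨ point i , x ⟩
    returned-dominates standing extreme 0≤ε (H , step1 , greedy) x x∈S
      with j , _ , ωP≡ ← ω-attained x ⊤ nonempty
      -- The maximiser j has x in its Voronoi cell, so it is an extreme point and some returned i
      -- covers it.
      with i , i∈X , i∈Q , j∈Dom ← greedy-covers H greedy
             (Equivalence.from (extreme j) (x , sphere⇒≉𝟎 x∈S , ≤-reflexive (reflexive ωP≡)))
      with x∈p∪q⁻ _ (H i) j∈Dom
    -- Here i itself attains ω(x , P), and 1 - ε ≤ 1.
    ... | inj₁ j∈i with ≡.refl ← x∈⁅y⁆⇒x≡y i j∈i = i , i∈Q , (begin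
      (1# - ε) * ωP P x  ≤⟨ *-monoˡ-≤ (proj₁ (standing x x∈S)) (x-y≤z⇒x-z≤y (≤-trans (≤-reflexive (-‿inverseʳ 1#)) 0≤ε)) ⟩
      1# * ωP P x        ≈⟨ *-identityˡ _ ⟩
      ωP P x             ≡⟨ ωP≡ ⟩
      ⟨ point i , x ⟩    ∎)
    ... | inj₂ j∈H with _ , _ , search ← step1 i i∈X with search-sound search j∈H
    ...   | inj₁ j∈∅ = contradiction j∈∅ ∉⊥
    -- The value `⊤⁺` is not below `[ ε ]`, so an accepted edge always comes from an attained
    -- optimum.
    ...   | inj₂ (_ , attained optimum , [ v≤ε ]) = i , i∈Q , optimum⇒dominates optimum v≤ε (standing x x∈S) ωP≡

theorem4 : (ℝ : Reals) → let open Reals ℝ in let open Regret ℝ in let open PointSet in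
    (d : ℕ) → .{{NonZero d}} →
    (P : PointSet d) (standing : StandingCondition P) →
    (X : Subset (size P)) → IsExtremeSet P X →
    (N : Fin (size P) → Subset (size P)) → IsDelaunayGraph P X N →
    (ε : Carrier) → 0# < ε → ε < 1# →
    (Q : Subset (size P)) → HGRMR.Returns P X N ε Q →
    IsRegretSet P standing ε Q
theorem4 ℝ (suc d) P standing X extreme N _ ε (0≤ε , _) (ε≤1 , _) Q returns =
  isRegretSet⁺ standing (proj₁ witness , proj₁ (proj₂ witness)) x₀ ε≤1 dominates
  where
  open RegretProperties ℝ P
  dominates = returned-dominates X N ε standing extreme 0≤ε returns
  -- Positive dimension supplies a unit vector; the point that dominates in its direction shows that
  -- `Q` is nonempty.
  x₀ = InnerProduct.unitVector ℝ {d}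
  witness = dominates (proj₁ x₀) (proj₂ x₀)
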